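{- Let $G=(U,V,E)$ be a stochastic graph with downward-closed online probing constraints $(\mathcal{C}_v)_{v\in V}$. Let $\mathrm{OPT}(G)$ be the expected weight of the matching returned by an optimal offline probing algorithm on $G$, and let $\mathrm{LPOPT}(G)$ be the optimal value of the configuration linear program of $G$. Then $$\mathrm{OPT}(G)\le \mathrm{LPOPT}(G).$$
   Context: Stochastic graph: a bipartite graph $G=(U,V,E)$ with finite vertex sets $U$ (offline) and $V$ (online), $E=U\times V$, edge weights $w_e\ge 0$ and edge probabilities $p_e\in[0,1]$. $\partial(r)$ denotes the set of edges containing the vertex $r$. Each edge $e$ is active independently with probability $p_e$; its state $\mathrm{st}(e)\sim\mathrm{Ber}(p_e)$ is the indicator of this event. For a set $S$ of edges, $S^{(*)}$ is the set of strings (tuples) with pairwise distinct entries from $S$, including the empty string $\lambda$. Each $v\in V$ has an online probing constraint $\mathcal{C}_v\subseteq \partial(v)^{(*)}$, with $\lambda\in\mathcal{C}_v$, which is downward-closed: if $\bm{e}\in\mathcal{C}_v$ then every substring and every permutation of $\bm{e}$ is in $\mathcal{C}_v$. Offline probing algorithm: it knows $G$ (all weights, probabilities and constraints) but not the edge states. It may be randomized and adaptively probes edges one at a time, in any order (possibly interleaving edges of different vertices of $V$); a probe of $e$ reveals $\mathrm{st}(e)$. For each $v\in V$ the sequence of probed edges of $\partial(v)$, in the order probed, must be a member of $\mathcal{C}_v$. Probe-commit: when a probed edge is active, the algorithm must irrevocably decide whether to include it in its output before any further probe. The output $\mathcal{M}$ must be a matching of probed active edges. $\mathrm{OPT}(G)$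 is the maximum of $\mathbb{E}[\sum_{e\in\mathcal{M}}w_e]$ over all offline probing algorithms. Configuration LP: for $\bm{e}\in E^{(*)}$ let $q(\bm{e})=\prod_{f\in\bm{e}}(1-p_f)$, $q(\lambda)=1$; for an entry $f$ of $\bm{e}$ let $\bm{e}_{<f}$ be the prefix of $\bm{e}$ strictly before $f$; let $\mathrm{val}(\bm{e})=\sum_{f\in\bm{e}}w_f\,p_f\,q(\bm{e}_{<f})$. $\mathrm{LPOPT}(G)$ is the maximum of $\sum_{v\in V}\sum_{\bm{e}\in\mathcal{C}_v}\mathrm{val}(\bm{e})\,x_v(\bm{e})$ over all $x_v(\bm{e})\ge 0$ ($v\in V$, $\bm{e}\in\mathcal{C}_v$) satisfying $\sum_{v\in V}\sum_{\bm{e}\in\mathcal{C}_v:(u,v)\in\bm{e}}p_{u,v}\,q(\bm{e}_{<(u,v)})\,x_v(\bm{e})\le 1$ for all $u\in U$, and $\sum_{\bm{e}\in\mathcal{C}_v}x_v(\bm{e})=1$ for all $v\in V$. -}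

module Defs where

open import Level using (Level; _⊔_; suc)
open import Algebra.Bundles using (CommutativeRing)
open import Data.Bool using (Bool; true; false; if_then_else_)
open import Data.Fin using (Fin)
import Data.Fin.Properties as Fin
open import Data.List using (List; []; _∷_; map; foldr; filter; takeWhile; allFin; cartesianProduct; cartesianProductWith)
open import Data.List.Membership.Propositional using (_∈_)
import Data.List.Membership.DecPropositional as DecMembership
open import Data.List.Relation.Binary.Infix.Heterogeneous using (Infix)
open import Data.List.Relation.Binary.Permutation.Propositional using (_↭_)
open import Data.List.Relation.Unary.All using (All)
open import Data.List.Relation.Unary.AllPairs using (AllPairs)
open import Data.List.Relation.Unary.Unique.Propositional using (Unique)
open import Data.Nat using (ℕ)
open import Data.Product using (∃; _×_; _,_; proj₁; proj₂)
open import Data.Product.Properties using (≡-dec)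
open import Data.Vec using (Vec; []; _∷_; lookup)
open import Relation.Binary.Definitions using (DecidableEquality)
open import Relation.Binary.PropositionalEquality using (_≡_; _≢_)
open import Relation.Binary.Structures using (IsTotalOrder)
open import Relation.Nullary using (¬_; ¬?)

-- Linearly ordered fields.  The library has no real numbers; weights,
-- probabilities and LP variables take values in an arbitrary linearly ordered
-- field, of which ℝ is one.
record OrderedField c ℓ₁ ℓ₂ : Set (suc (c ⊔ ℓ₁ ⊔ ℓ₂)) where
  field
    commutativeRing : CommutativeRing c ℓ₁

  open CommutativeRing commutativeRing public

  infix 4 _≤_

  field
    1≉0          : ¬ 1# ≈ 0#
    inverse      : ∀ x → ¬ x ≈ 0# → ∃ λ y → x * y ≈ 1#
    _≤_          : Carrier → Carrier → Set ℓ₂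
    isTotalOrder : IsTotalOrder _≈_ _≤_
    +-monoˡ-≤    : ∀ {x y} z → x ≤ y → x + z ≤ y + z
    *-nonneg     : ∀ {x y} → 0# ≤ x → 0# ≤ y → 0# ≤ x * y

-- All vectors of length k with entries drawn from xs.
allVecs : ∀ {a} {A : Set a} → List A → (k : ℕ) → List (Vec A k)
allVecs xs ℕ.zero    = [] ∷ []
allVecs xs (ℕ.suc k) = cartesianProductWith _∷_ xs (allVecs xs k)

module _ {c ℓ₁ ℓ₂} (F : OrderedField c ℓ₁ ℓ₂) where
  open OrderedField F

  infix 5 ∑ ∏

  ∑ ∏ : ∀ {a} {A : Set a} → List A → (A → Carrier) → Carrier
  ∑ xs f = foldr _+_ 0# (map f xs)
  ∏ xs f = foldr _*_ 1# (map f xs)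

  syntax ∑ xs (λ x → t) = ∑[ x ∈ xs ] t
  syntax ∏ xs (λ x → t) = ∏[ x ∈ xs ] t

  IsMaximum : ∀ {a} {A : Set a} → (A → Carrier) → Carrier → Set (a ⊔ ℓ₁ ⊔ ℓ₂)
  IsMaximum f m = (∃ λ a → f a ≈ m) × (∀ a → f a ≤ m)

  -- U = Fin |U|, V = Fin |V| and E = U × V.  The set 𝒞 v of strings is given
  -- by a duplicate-free enumeration, so that sums over it are list sums.
  record StochasticGraph : Set (c ⊔ ℓ₂) where
    field
      |U| |V| : ℕ

    Edge : Set
    Edge = Fin |U| × Fin |V|

    String : Set
    String = List Edge

    field
      w     : Edge → Carrier
      w≥0   : ∀ e → 0# ≤ w e
      p     : Edge → Carrier
      p≥0   : ∀ e → 0# ≤ p e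
      p≤1   : ∀ e → p e ≤ 1#

      𝒞          : Fin |V| → List String
      𝒞-unique   : ∀ v → Unique (𝒞 v)
      𝒞-at       : ∀ {v es} → es ∈ 𝒞 v → All (λ e → proj₂ e ≡ v) es
      𝒞-distinct : ∀ {v es} → es ∈ 𝒞 v → Unique es
      λ∈𝒞        : ∀ v → [] ∈ 𝒞 v

      -- Contiguous substrings; with closure under permutations this already
      -- gives closure under arbitrary subsequences.
      𝒞-substring   : ∀ {v es es′} → es ∈ 𝒞 v → Infix _≡_ es′ es → es′ ∈ 𝒞 v
      𝒞-permutation : ∀ {v es es′} → es ∈ 𝒞 v → es ↭ es′ → es′ ∈ 𝒞 v

  module _ (G : StochasticGraph) where
    open StochasticGraph G

    _≟ᴱ_ : DecidableEquality Edge
    _≟ᴱ_ = ≡-dec Fin._≟_ Fin._≟_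

    open DecMembership _≟ᴱ_ using (_∈?_)

    edges : List Edge
    edges = cartesianProduct (allFin |U|) (allFin |V|)

    -- A realisation of all edge states, true meaning active.
    States : Set
    States = Vec (Vec Bool |V|) |U|

    st : States → Edge → Bool
    st s (u , v) = lookup (lookup s u) v

    allStates : List States
    allStates = allVecs (allVecs (true ∷ false ∷ []) |V|) |U|

    Pr : States → Carrier
    Pr s = ∏[ e ∈ edges ] (if st s e then p e else 1# - p e)

    -- A deterministic adaptive probing strategy.  In  probe e b t₁ t₀  the edge
    -- e is probed; if it is active, it is put into the output exactly when b is
    -- true, and the strategy continues with t₁; if inactive, with t₀.
    data Strategy : Set where
      stop  : Strategy
      probe : Edge → Bool → Strategy → Strategy → Strategy

    probed : Strategy → States → String
    probed stop              s = []
    probed (probe e b t₁ t₀) s = e ∷ (if st s e then probed t₁ s else probed t₀ s)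

    output : Strategy → States → List Edge
    output stop              s = []
    output (probe e b t₁ t₀) s =
      if st s e then (if b then e ∷ output t₁ s else output t₁ s)
                else output t₀ s

    IsMatching : List Edge → Set
    IsMatching = AllPairs (λ e f → proj₁ e ≢ proj₁ f × proj₂ e ≢ proj₂ f)

    record Admissible (t : Strategy) : Set where
      field
        constraint : ∀ s v → filter (λ e → proj₂ e Fin.≟ v) (probed t s) ∈ 𝒞 v
        matching   : ∀ s → IsMatching (output t s)

    -- A randomised algorithm draws a seed, independently of the edge states,
    -- and then follows the strategy selected by the seed.  Finitely many seeds
    -- suffice, as there are only finitely many admissible strategies up to
    -- branches that no realisation of the states reaches.
    record OfflineProbingAlgorithm : Set (c ⊔ ℓ₁ ⊔ ℓ₂) where
      field
        seeds      : ℕ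
        π          : Fin seeds → Carrier
        π≥0        : ∀ r → 0# ≤ π r
        ∑π≈1       : ∑[ r ∈ allFin seeds ] π r ≈ 1#
        strategy   : Fin seeds → Strategy
        admissible : ∀ r → Admissible (strategy r)

    expectedWeight : OfflineProbingAlgorithm → Carrier
    expectedWeight A =
      ∑[ r ∈ allFin seeds ] ∑[ s ∈ allStates ]
        π r * Pr s * (∑[ e ∈ output (strategy r) s ] w e)
      where open OfflineProbingAlgorithm A

    IsOPT : Carrier → Set (c ⊔ ℓ₁ ⊔ ℓ₂)
    IsOPT = IsMaximum expectedWeight

    q : String → Carrier
    q es = ∏[ f ∈ es ] (1# - p f)

    -- The prefix of es strictly before (the first occurrence of) f.
    before : Edge → String → String
    before f = takeWhile (λ g → ¬? (g ≟ᴱ f))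

    val : String → Carrier
    val es = ∑[ f ∈ es ] w f * p f * q (before f es)

    -- Only the values x v es with es ∈ 𝒞 v are constrained or used.
    record LPSolution : Set (c ⊔ ℓ₁ ⊔ ℓ₂) where
      field
        x        : Fin |V| → String → Carrier
        x≥0      : ∀ v {es} → es ∈ 𝒞 v → 0# ≤ x v es
        capacity : ∀ u →
          ∑[ v ∈ allFin |V| ] ∑[ es ∈ filter ((u , v) ∈?_) (𝒞 v) ]
            p (u , v) * q (before (u , v) es) * x v es
          ≤ 1#
        total    : ∀ v → ∑[ es ∈ 𝒞 v ] x v es ≈ 1#

    objective : LPSolution → Carrier
    objective X = ∑[ v ∈ allFin |V| ] ∑[ es ∈ 𝒞 v ] val es * x v es
      where open LPSolution X

    IsLPOPT : Carrier → Set (c ⊔ ℓ₁ ⊔ ℓ₂)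
    IsLPOPT = IsMaximum objective

{-# OPTIONS --safe #-}

module Submission where

-- Given an offline algorithm, let v play alone: walk down the algorithm's
-- decision tree, drawing the outcomes of all probes that the algorithm would not
-- accept at v as private randomness, and append to a string each edge that it
-- would accept at v, continuing as if that edge were inactive.  After a real
-- acceptance nothing more is matched to v, so committing to the first active edge
-- of this random string matches each edge at v with exactly the same probability
-- as the algorithm does.  The string is a subsequence of the edges probed on a path of
-- the tree, hence in 𝒞 v.  The laws of these strings, one for each v, form a
-- feasible LP solution whose objective is the expected weight of the algorithm.

open import Algebra.Bundles using (Monoid)
import Algebra.Properties.CommutativeSemigroup as CommutativeSemigroupProperties
import Algebra.Properties.Ring as RingProperties
open import Data.Bool using (Bool; true; false; if_then_else_; _∧_)
open import Data.Fin using (Fin; zero; suc)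
import Data.Fin.Properties as Fin
open import Data.List using (List; []; _∷_; _++_; map; foldr; filter; allFin; cartesianProductWith)
open import Data.List.Membership.Propositional using (_∈_; _∉_)
open import Data.List.Membership.Propositional.Properties using (∈-allFin; ∈-filter⁺)
open import Data.List.Properties using (map-tabulate; filter-accept; ≡-dec)
open import Data.List.Relation.Binary.Infix.Heterogeneous using (here)
open import Data.List.Relation.Binary.Permutation.Propositional using (_↭_; ↭-refl; ↭-trans; ↭-sym; prep)
open import Data.List.Relation.Binary.Permutation.Propositional.Properties using (shift)
open import Data.List.Relation.Binary.Prefix.Heterogeneous using (Prefix; []; _∷_)
open import Data.List.Relation.Binary.Sublist.Propositional using (_⊆_; []; _∷_; _∷ʳ_; ⊆-refl; ⊆-trans)
open import Data.List.Relation.Binary.Sublist.Propositional.Properties using (filter⁺)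
open import Data.List.Relation.Unary.All as All using (All; []; _∷_)
open import Data.List.Relation.Unary.Any using (here; there)
open import Data.List.Relation.Unary.AllPairs using ([]; _∷_)
open import Data.List.Relation.Unary.Unique.Propositional using (Unique)
open import Data.List.Relation.Unary.Unique.Propositional.Properties using (allFin⁺)
open import Data.Nat using (ℕ)
open import Data.Product using (∃; _,_; proj₁; proj₂)
open import Data.Sum using (inj₁; inj₂)
open import Data.Vec as Vec using (Vec; []; _∷_; lookup; _[_]≔_)
open import Data.Vec.Properties using (lookup∘update; lookup∘update′; []≔-idempotent)
open import Function using (_∘_; const; id)
open import Level using (Level)
open import Relation.Binary.Definitions using (DecidableEquality)
open import Relation.Binary.PropositionalEquality as ≡ using (_≡_; _≢_)
import Relation.Binary.Reasoning.Setoid as SetoidReasoning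
open import Relation.Binary.Structures using (IsTotalOrder)
open import Relation.Nullary using (Dec; ¬_; does; yes; no)
open import Relation.Nullary.Decidable using (dec-true; dec-false)
open import Relation.Unary using (Pred; Decidable)

open import Defs

-- Folds in a monoid, sublists and duplicate-free lists.

module _ {a ℓ} (M : Monoid a ℓ) where
  open Monoid M
  open SetoidReasoning setoid

  private
    fold : ∀ {b} {A : Set b} → List A → (A → Carrier) → Carrier
    fold xs f = foldr _∙_ ε (map f xs)

  fold-++ : ∀ {b} {A : Set b} (xs ys : List A) (f : A → Carrier) →
            fold (xs ++ ys) f ≈ fold xs f ∙ fold ys f
  fold-++ []       ys f = sym (identityˡ _)
  fold-++ (x ∷ xs) ys f = trans (∙-congˡ (fold-++ xs ys f)) (sym (assoc _ _ _))

  -- Needed for both monoids of the field: additively it splits sums over `allVecs`,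
  -- multiplicatively it groups the product over `edges` into rows.
  fold-cartesianProductWith :
    ∀ {b} {A B C : Set b} (_⊗_ : A → B → C) xs ys (f : C → Carrier) →
    fold (cartesianProductWith _⊗_ xs ys) f ≈ fold xs (λ x → fold ys (λ y → f (x ⊗ y)))
  fold-cartesianProductWith _⊗_ []       ys f = refl
  fold-cartesianProductWith _⊗_ (x ∷ xs) ys f =
    trans (fold-++ (map (x ⊗_) ys) _ f)
          (∙-cong (reflexive (fold-map ys)) (fold-cartesianProductWith _⊗_ xs ys f))
    where
    fold-map : ∀ zs → fold (map (x ⊗_) zs) f ≡ fold zs (λ y → f (x ⊗ y))
    fold-map []       = ≡.refl
    fold-map (z ∷ zs) = ≡.cong (f (x ⊗ z) ∙_) (fold-map zs)

-- Turns a subsequence into a prefix after a permutation, the form to which the closure properties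
-- of `𝒞` apply.
sublist⇒↭++ : ∀ {a} {A : Set a} {xs ys : List A} → xs ⊆ ys → ∃ λ zs → ys ↭ xs ++ zs
sublist⇒↭++ []             = [] , ↭-refl
sublist⇒↭++ {xs = xs} (y ∷ʳ s) with zs , ys↭ ← sublist⇒↭++ s =
  y ∷ zs , ↭-trans (prep y ys↭) (↭-sym (shift y xs zs))
sublist⇒↭++ (≡.refl ∷ s) with zs , ys↭ ← sublist⇒↭++ s = zs , prep _ ys↭

prefix-++ : ∀ {a} {A : Set a} (xs ys : List A) → Prefix _≡_ xs (xs ++ ys)
prefix-++ []       ys = []
prefix-++ (x ∷ xs) ys = ≡.refl ∷ prefix-++ xs ys

-- Two equal entries have the same image under `f`, so a repetition would already show up inside a
-- single fibre.
unique-fibres : ∀ {a b} {A : Set a} {B : Set b} (_≟_ : DecidableEquality B) (f : A → B) {xs} →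
                (∀ b → Unique (filter (λ x → f x ≟ b) xs)) → Unique xs
unique-fibres _≟_ f {[]}     u = []
unique-fibres _≟_ f {x ∷ xs} u = All.tabulate fresh ∷ unique-fibres _≟_ f tails
  where
  fresh : ∀ {y} → y ∈ xs → x ≢ y
  fresh x∈xs ≡.refl with ≡.subst Unique (filter-accept (λ y → f y ≟ f x) ≡.refl) (u (f x))
  ... | x∉ ∷ _ = All.lookup x∉ (∈-filter⁺ (λ y → f y ≟ f x) x∈xs ≡.refl) ≡.refl

  tails : ∀ b → Unique (filter (λ y → f y ≟ b) xs)
  tails b with does (f x ≟ b) | u b
  ... | true  | _ ∷ u′ = u′
  ... | false | u′     = u′

module _ {c ℓ₁ ℓ₂} (F : OrderedField c ℓ₁ ℓ₂) where
  open OrderedField F hiding (zero)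
  open IsTotalOrder isTotalOrder using (total; ≤-respˡ-≈; ≤-respʳ-≈)
    renaming (refl to ≤-refl; trans to ≤-trans; reflexive to ≤-reflexive)
  open SetoidReasoning setoid
  open RingProperties ring using (-‿distribˡ-*; -‿involutive; x[y-z]≈xy-xz)
  open CommutativeSemigroupProperties +-commutativeSemigroup using () renaming (interchange to +-interchange)
  open CommutativeSemigroupProperties *-commutativeSemigroup using () renaming (x∙yz≈y∙xz to x*yz≈y*xz)

  private variable
    a b : Level
    A : Set a
    B : Set b
    k : ℕ

  -- Ordered-field arithmetic, finite sums and indicators.

  +-mono-≤ : ∀ {x y z t} → x ≤ y → z ≤ t → x + z ≤ y + t
  +-mono-≤ {x} {y} {z} {t} x≤y z≤t = ≤-trans (+-monoˡ-≤ z x≤y)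
    (≤-respˡ-≈ (+-comm z y) (≤-respʳ-≈ (+-comm t y) (+-monoˡ-≤ y z≤t)))

  x+[y-x]≈y : ∀ x y → x + (y - x) ≈ y
  x+[y-x]≈y x y = begin
    x + (y - x)   ≈⟨ +-congˡ (+-comm y (- x)) ⟩
    x + (- x + y) ≈⟨ +-assoc x (- x) y ⟨
    x - x + y     ≈⟨ +-congʳ (-‿inverseʳ x) ⟩
    0# + y        ≈⟨ +-identityˡ y ⟩
    y             ∎

  x≤y⇒0≤y-x : ∀ {x y} → x ≤ y → 0# ≤ y - x
  x≤y⇒0≤y-x {x} x≤y = ≤-respˡ-≈ (-‿inverseʳ x) (+-monoˡ-≤ (- x) x≤y)

  0≤y-x⇒x≤y : ∀ {x y} → 0# ≤ y - x → x ≤ y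
  0≤y-x⇒x≤y {x} {y} 0≤ =
    ≤-respˡ-≈ (+-identityˡ x) (≤-respʳ-≈ (trans (+-comm _ x) (x+[y-x]≈y x y)) (+-monoˡ-≤ x 0≤))

  *-monoˡ-≤ : ∀ {x y z} → 0# ≤ z → x ≤ y → z * x ≤ z * y
  *-monoˡ-≤ {x} {y} {z} 0≤z x≤y =
    0≤y-x⇒x≤y (≤-respʳ-≈ (x[y-z]≈xy-xz z y x) (*-nonneg 0≤z (x≤y⇒0≤y-x x≤y)))

  0≤1 : 0# ≤ 1#
  0≤1 with total 0# 1#
  ... | inj₁ 0≤1 = 0≤1
  -- If `1# ≤ 0#`, then `- 1#` is nonnegative, and so is its square, which is `1#`.
  ... | inj₂ 1≤0 = ≤-respʳ-≈ -1*-1≈1 (*-nonneg 0≤-1 0≤-1)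
    where
    0≤-1 : 0# ≤ - 1#
    0≤-1 = ≤-respʳ-≈ (+-identityˡ (- 1#)) (x≤y⇒0≤y-x 1≤0)

    -1*-1≈1 : - 1# * - 1# ≈ 1#
    -1*-1≈1 = begin
      - 1# * - 1#   ≈⟨ -‿distribˡ-* 1# (- 1#) ⟨
      - (1# * - 1#) ≈⟨ -‿cong (*-identityˡ (- 1#)) ⟩
      - - 1#        ≈⟨ -‿involutive 1# ⟩
      1#            ∎

  ∑-cong : ∀ (xs : List A) {f g : A → Carrier} → (∀ {x} → x ∈ xs → f x ≈ g x) → ∑ F xs f ≈ ∑ F xs g
  ∑-cong []       f≈g = refl
  ∑-cong (x ∷ xs) f≈g = +-cong (f≈g (here ≡.refl)) (∑-cong xs (f≈g ∘ there))

  ∑-zero : ∀ (xs : List A) → ∑ F xs (const 0#) ≈ 0#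
  ∑-zero []       = refl
  ∑-zero (x ∷ xs) = trans (+-identityˡ _) (∑-zero xs)

  ∑-distrib-+ : ∀ (xs : List A) (f g : A → Carrier) → ∑ F xs (λ x → f x + g x) ≈ ∑ F xs f + ∑ F xs g
  ∑-distrib-+ []       f g = sym (+-identityˡ 0#)
  ∑-distrib-+ (x ∷ xs) f g = trans (+-congˡ (∑-distrib-+ xs f g)) (+-interchange _ _ _ _)

  *-distribˡ-∑ : ∀ (xs : List A) z (f : A → Carrier) → z * ∑ F xs f ≈ ∑ F xs (λ x → z * f x)
  *-distribˡ-∑ []       z f = zeroʳ z
  *-distribˡ-∑ (x ∷ xs) z f = trans (distribˡ z _ _) (+-congˡ (*-distribˡ-∑ xs z f))

  ∑-swap : ∀ (xs : List A) (ys : List B) (f : A → B → Carrier) →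
           ∑ F xs (λ x → ∑ F ys (f x)) ≈ ∑ F ys (λ y → ∑ F xs (λ x → f x y))
  ∑-swap []       ys f = sym (∑-zero ys)
  ∑-swap (x ∷ xs) ys f = trans (+-congˡ (∑-swap xs ys f)) (sym (∑-distrib-+ ys (f x) _))

  ∑-mono : ∀ (xs : List A) {f g : A → Carrier} → (∀ x → f x ≤ g x) → ∑ F xs f ≤ ∑ F xs g
  ∑-mono []       f≤g = ≤-refl
  ∑-mono (x ∷ xs) f≤g = +-mono-≤ (f≤g x) (∑-mono xs f≤g)

  ∑-nonneg : ∀ (xs : List A) {f : A → Carrier} → (∀ x → 0# ≤ f x) → 0# ≤ ∑ F xs f
  ∑-nonneg xs 0≤f = ≤-respˡ-≈ (∑-zero xs) (∑-mono xs 0≤f)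

  ∏-nonneg : ∀ (xs : List A) {f : A → Carrier} → (∀ x → 0# ≤ f x) → 0# ≤ ∏ F xs f
  ∏-nonneg []       0≤f = 0≤1
  ∏-nonneg (x ∷ xs) 0≤f = *-nonneg (0≤f x) (∏-nonneg xs 0≤f)

  ∑-filter : ∀ {p} {P : Pred A p} (P? : Decidable P) xs {f g : A → Carrier} →
             (∀ {x} → x ∈ xs → P x → f x ≈ g x) → (∀ {x} → x ∈ xs → ¬ P x → g x ≈ 0#) →
             ∑ F (filter P? xs) f ≈ ∑ F xs g
  ∑-filter P? []       f≈g g≈0 = refl
  ∑-filter P? (x ∷ xs) f≈g g≈0 with P? x
  ... | yes Px = +-cong (f≈g (here ≡.refl) Px) (∑-filter P? xs (f≈g ∘ there) (g≈0 ∘ there))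
  ... | no ¬Px = trans (∑-filter P? xs (f≈g ∘ there) (g≈0 ∘ there))
                       (sym (trans (+-congʳ (g≈0 (here ≡.refl) ¬Px)) (+-identityˡ _)))

  module Indicator (_≟_ : DecidableEquality A) where

    δ : A → A → Carrier
    δ x y = if does (x ≟ y) then 1# else 0#

    δ-≡ : ∀ {x y} → x ≡ y → δ x y ≡ 1#
    δ-≡ {x} {y} x≡y rewrite dec-true (x ≟ y) x≡y = ≡.refl

    δ-≢ : ∀ {x y} → x ≢ y → δ x y ≡ 0#
    δ-≢ {x} {y} x≢y rewrite dec-false (x ≟ y) x≢y = ≡.refl

    δ-nonneg : ∀ x y → 0# ≤ δ x y
    δ-nonneg x y with does (x ≟ y)
    ... | true  = 0≤1
    ... | false = ≤-refl

    δ-absent : ∀ {xs y} (g : A → Carrier) → y ∉ xs → ∑ F xs (λ x → g x * δ x y) ≈ 0#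
    δ-absent {xs} g y∉xs =
      trans (∑-cong xs λ x∈xs → trans (*-congˡ (reflexive (δ-≢ λ { ≡.refl → y∉xs x∈xs }))) (zeroʳ _))
            (∑-zero xs)

    δ-select : ∀ {xs y} (g : A → Carrier) → Unique xs → y ∈ xs → ∑ F xs (λ x → g x * δ x y) ≈ g y
    δ-select {x ∷ xs} g (x∉ ∷ _) (here ≡.refl) = begin
      g x * δ x x + ∑ F xs (λ z → g z * δ z x)
        ≈⟨ +-cong (*-congˡ (reflexive (δ-≡ ≡.refl))) (δ-absent g λ x∈ → All.lookup x∉ x∈ ≡.refl) ⟩
      g x * 1# + 0# ≈⟨ +-identityʳ _ ⟩
      g x * 1#      ≈⟨ *-identityʳ _ ⟩
      g x           ∎
    δ-select {x ∷ xs} {y} g (x∉ ∷ u) (there y∈) = begin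
      g x * δ x y + ∑ F xs (λ z → g z * δ z y)
        ≈⟨ +-cong (*-congˡ (reflexive (δ-≢ (All.lookup x∉ y∈)))) (δ-select g u y∈) ⟩
      g x * 0# + g y ≈⟨ +-congʳ (zeroʳ _) ⟩
      0# + g y       ≈⟨ +-identityˡ _ ⟩
      g y            ∎

  -- Finite expectations and product laws.

  𝔼 : List A → (A → Carrier) → (A → Carrier) → Carrier
  𝔼 xs μ f = ∑ F xs (λ x → μ x * f x)

  -- Records the total mass alone; the lemmas on inequalities take nonnegativity of the weights as a
  -- separate argument.
  IsProbability : List A → (A → Carrier) → Set _
  IsProbability xs μ = 𝔼 xs μ (const 1#) ≈ 1#

  𝔼-cong : ∀ (xs : List A) μ {f g} → (∀ x → f x ≈ g x) → 𝔼 xs μ f ≈ 𝔼 xs μ g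
  𝔼-cong xs μ f≈g = ∑-cong xs λ _ → *-congˡ (f≈g _)

  𝔼-distrib-+ : ∀ (xs : List A) μ f g → 𝔼 xs μ (λ x → f x + g x) ≈ 𝔼 xs μ f + 𝔼 xs μ g
  𝔼-distrib-+ xs μ f g =
    trans (∑-cong xs λ _ → distribˡ _ _ _) (∑-distrib-+ xs _ _)

  ∑-𝔼-swap : ∀ (xs : List A) μ (ys : List B) (f : B → A → Carrier) →
             ∑ F ys (λ y → 𝔼 xs μ (f y)) ≈ 𝔼 xs μ (λ x → ∑ F ys (λ y → f y x))
  ∑-𝔼-swap xs μ ys f =
    trans (∑-swap ys xs _) (∑-cong xs λ _ → sym (*-distribˡ-∑ ys _ _))

  *-𝔼 : ∀ (xs : List A) μ z f → z * 𝔼 xs μ f ≈ 𝔼 xs μ (λ x → z * f x)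
  *-𝔼 xs μ z f = trans (*-distribˡ-∑ xs z _) (∑-cong xs λ _ → x*yz≈y*xz z _ _)

  𝔼-𝔼-swap : ∀ (xs : List A) μ (ys : List B) ν (f : B → A → Carrier) →
             𝔼 ys ν (λ y → 𝔼 xs μ (f y)) ≈ 𝔼 xs μ (λ x → 𝔼 ys ν (λ y → f y x))
  𝔼-𝔼-swap xs μ ys ν f =
    trans (∑-cong ys λ _ → *-𝔼 xs μ _ _) (∑-𝔼-swap xs μ ys _)

  𝔼-const : ∀ (xs : List A) μ → IsProbability xs μ → ∀ z → 𝔼 xs μ (const z) ≈ z
  𝔼-const xs μ prob z = begin
    𝔼 xs μ (const z)        ≈⟨ 𝔼-cong xs μ (λ _ → sym (*-identityʳ z)) ⟩
    𝔼 xs μ (const (z * 1#)) ≈⟨ *-𝔼 xs μ z (const 1#) ⟨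
    z * 𝔼 xs μ (const 1#)   ≈⟨ *-congˡ prob ⟩
    z * 1#                  ≈⟨ *-identityʳ z ⟩
    z                       ∎

  𝔼-mono : ∀ (xs : List A) {μ f g} → (∀ x → 0# ≤ μ x) → (∀ x → f x ≤ g x) → 𝔼 xs μ f ≤ 𝔼 xs μ g
  𝔼-mono xs 0≤μ f≤g = ∑-mono xs λ x → *-monoˡ-≤ (0≤μ x) (f≤g x)

  𝔼-nonneg : ∀ (xs : List A) {μ f} → (∀ x → 0# ≤ μ x) → (∀ x → 0# ≤ f x) → 0# ≤ 𝔼 xs μ f
  𝔼-nonneg xs 0≤μ 0≤f = ∑-nonneg xs λ x → *-nonneg (0≤μ x) (0≤f x)

  productWeight : (Fin k → A → Carrier) → Vec A k → Carrier
  productWeight {k = k} μ v = ∏ F (allFin k) (λ i → μ i (lookup v i))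

  ∏-allFin-suc : ∀ k (f : Fin (ℕ.suc k) → Carrier) →
                 ∏ F (allFin (ℕ.suc k)) f ≡ f zero * ∏ F (allFin k) (f ∘ suc)
  ∏-allFin-suc k f = ≡.cong (λ xs → f zero * foldr _*_ 1# xs)
    (≡.trans (map-tabulate suc f) (≡.sym (map-tabulate id (f ∘ suc))))

  -- Fubini for the first coordinate: the product weight is the weight of the head times the product
  -- weight of the tail.
  𝔼-allVecs-suc : ∀ (xs : List A) (μ : Fin (ℕ.suc k) → A → Carrier) g →
    𝔼 (allVecs xs (ℕ.suc k)) (productWeight μ) g
      ≈ 𝔼 xs (μ zero) (λ x → 𝔼 (allVecs xs k) (productWeight (μ ∘ suc)) (λ v → g (x ∷ v)))
  𝔼-allVecs-suc {k = k} xs μ g = trans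
    (fold-cartesianProductWith +-monoid _∷_ xs (allVecs xs k) _)
    (∑-cong xs λ {x} _ → trans
      (∑-cong (allVecs xs k) λ {v} _ → trans
        (*-congʳ (reflexive (∏-allFin-suc k (λ i → μ i (lookup (x ∷ v) i)))))
        (*-assoc _ _ _))
      (sym (*-distribˡ-∑ (allVecs xs k) (μ zero x) _)))

  allVecs-probability : ∀ (xs : List A) (μ : Fin k → A → Carrier) →
    (∀ i → IsProbability xs (μ i)) → IsProbability (allVecs xs k) (productWeight μ)
  allVecs-probability {k = ℕ.zero}  xs μ prob = trans (+-identityʳ _) (*-identityˡ _)
  allVecs-probability {k = ℕ.suc k} xs μ prob = begin
    𝔼 (allVecs xs (ℕ.suc k)) (productWeight μ) (const 1#) ≈⟨ 𝔼-allVecs-suc xs μ _ ⟩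
    𝔼 xs (μ zero) _
      ≈⟨ 𝔼-cong xs (μ zero) (λ _ → allVecs-probability xs (μ ∘ suc) (prob ∘ suc)) ⟩
    𝔼 xs (μ zero) (const 1#)                              ≈⟨ prob zero ⟩
    1#                                                    ∎

  -- Coordinates are independent under a product law, so overwriting one of them by a fresh draw
  -- does not change the law.
  𝔼-resample : ∀ (xs : List A) (μ : Fin k → A → Carrier) → (∀ i → IsProbability xs (μ i)) →
    ∀ i g → 𝔼 (allVecs xs k) (productWeight μ) g
              ≈ 𝔼 xs (μ i) (λ x → 𝔼 (allVecs xs k) (productWeight μ) (λ v → g (v [ i ]≔ x)))
  𝔼-resample {k = ℕ.suc k} xs μ prob zero g = begin
    𝔼 (allVecs xs (ℕ.suc k)) (productWeight μ) g ≈⟨ 𝔼-allVecs-suc xs μ g ⟩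
    𝔼 xs (μ zero) (λ x → 𝔼 (allVecs xs k) (productWeight (μ ∘ suc)) (λ v → g (x ∷ v)))
      -- Read from right to left: once overwritten, the old head no longer occurs in the integrand,
      -- so averaging over it has no effect.
      ≈⟨ 𝔼-cong xs (μ zero) (λ x → trans (𝔼-allVecs-suc xs μ _) (𝔼-const xs (μ zero) (prob zero) _)) ⟨
    𝔼 xs (μ zero) (λ x → 𝔼 (allVecs xs (ℕ.suc k)) (productWeight μ) (λ v → g (v [ zero ]≔ x))) ∎
  𝔼-resample {k = ℕ.suc k} xs μ prob (suc i) g = begin
    𝔼 (allVecs xs (ℕ.suc k)) (productWeight μ) g ≈⟨ 𝔼-allVecs-suc xs μ g ⟩
    𝔼 xs (μ zero) (λ y → 𝔼 (allVecs xs k) (productWeight (μ ∘ suc)) (λ v → g (y ∷ v)))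
      ≈⟨ 𝔼-cong xs (μ zero) (λ y → 𝔼-resample xs (μ ∘ suc) (prob ∘ suc) i _) ⟩
    𝔼 xs (μ zero) (λ y → 𝔼 xs (μ (suc i)) (λ x →
      𝔼 (allVecs xs k) (productWeight (μ ∘ suc)) (λ v → g (y ∷ v [ i ]≔ x))))
      ≈⟨ 𝔼-𝔼-swap xs (μ (suc i)) xs (μ zero) _ ⟩
    𝔼 xs (μ (suc i)) (λ x → 𝔼 xs (μ zero) (λ y →
      𝔼 (allVecs xs k) (productWeight (μ ∘ suc)) (λ v → g (y ∷ v [ i ]≔ x))))
      ≈⟨ 𝔼-cong xs (μ (suc i)) (λ x → 𝔼-allVecs-suc xs μ _) ⟨
    𝔼 xs (μ (suc i)) (λ x →
      𝔼 (allVecs xs (ℕ.suc k)) (productWeight μ) (λ v → g (v [ suc i ]≔ x))) ∎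

  -- Runs of a strategy and the product law of the edge states.

  module _ (G : StochasticGraph F) where
    open StochasticGraph G
    open Indicator (Fin._≟_ {|V|}) using () renaming (δ to δⱽ; δ-≡ to δⱽ-≡; δ-≢ to δⱽ-≢; δ-select to δⱽ-select)
    open Indicator (Fin._≟_ {|U|}) using () renaming (δ to δᵁ; δ-≡ to δᵁ-≡; δ-≢ to δᵁ-≢)
    open Indicator (≡-dec (_≟ᴱ_ F G)) using (δ; δ-nonneg; δ-select)

    -- The outcome of the root enters through an equation because, for forced states, it is provable
    -- but does not hold by computation.
    probed-step : ∀ {e d t₁ t₀ a s} → st F G s e ≡ a →
                  probed F G (probe e d t₁ t₀) s ≡ e ∷ probed F G (if a then t₁ else t₀) s
    probed-step {a = true}  eq rewrite eq = ≡.refl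
    probed-step {a = false} eq rewrite eq = ≡.refl

    output-step : ∀ {e d t₁ t₀ a s} → st F G s e ≡ a →
                  output F G (probe e d t₁ t₀) s ≡
                  (if a ∧ d then e ∷ output F G t₁ s else output F G (if a then t₁ else t₀) s)
    output-step {a = true}  eq rewrite eq = ≡.refl
    output-step {a = false} eq rewrite eq = ≡.refl

    at? : ∀ v → Decidable (λ (e : Edge) → proj₂ e ≡ v)
    at? v e = proj₂ e Fin.≟ v

    matching-branch : ∀ a d {e t₁ t₀ s} →
      IsMatching F G (if a ∧ d then e ∷ output F G t₁ s else output F G (if a then t₁ else t₀) s) →
      IsMatching F G (output F G (if a then t₁ else t₀) s)
    matching-branch true  true  (_ ∷ m) = m
    matching-branch true  false m       = m
    matching-branch false _     m       = m

    bernoulli : Edge → Bool → Carrier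
    bernoulli e a = if a then p e else 1# - p e

    bernoulli-nonneg : ∀ e a → 0# ≤ bernoulli e a
    bernoulli-nonneg e true  = p≥0 e
    bernoulli-nonneg e false = x≤y⇒0≤y-x (p≤1 e)

    bernoulli-probability : ∀ e → IsProbability (true ∷ false ∷ []) (bernoulli e)
    bernoulli-probability e = begin
      p e * 1# + ((1# - p e) * 1# + 0#) ≈⟨ +-cong (*-identityʳ _) (trans (+-identityʳ _) (*-identityʳ _)) ⟩
      p e + (1# - p e)                  ≈⟨ x+[y-x]≈y (p e) 1# ⟩
      1#                                ∎

    mix-const : ∀ e z → p e * z + (1# - p e) * z ≈ z
    mix-const e z = begin
      p e * z + (1# - p e) * z ≈⟨ distribʳ z _ _ ⟨
      (p e + (1# - p e)) * z   ≈⟨ *-congʳ (x+[y-x]≈y (p e) 1#) ⟩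
      1# * z                   ≈⟨ *-identityˡ z ⟩
      z                        ∎

    𝔼ₛ : (States F G → Carrier) → Carrier
    𝔼ₛ = 𝔼 (allStates F G) (Pr F G)

    rows : List (Vec Bool |V|)
    rows = allVecs (true ∷ false ∷ []) |V|

    rowWeight : Fin |U| → Vec Bool |V| → Carrier
    rowWeight u = productWeight (λ v → bernoulli (u , v))

    rowWeight-probability : ∀ u → IsProbability rows (rowWeight u)
    rowWeight-probability u =
      allVecs-probability _ (λ v → bernoulli (u , v)) (λ v → bernoulli-probability (u , v))

    -- Regroups `Pr` as a product law on rows, each row being itself a product of Bernoulli laws, so
    -- that resampling applies at both levels.
    𝔼ₛ-rows : ∀ g → 𝔼ₛ g ≈ 𝔼 (allVecs rows |U|) (productWeight rowWeight) g
    𝔼ₛ-rows g = ∑-cong (allVecs rows |U|) λ _ →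
      *-congʳ (fold-cartesianProductWith *-monoid _,_ (allFin |U|) (allFin |V|) _)

    Pr-probability : IsProbability (allStates F G) (Pr F G)
    Pr-probability = trans (𝔼ₛ-rows _) (allVecs-probability rows rowWeight rowWeight-probability)

    𝔼ₛ-const : ∀ z → 𝔼ₛ (const z) ≈ z
    𝔼ₛ-const = 𝔼-const (allStates F G) (Pr F G) Pr-probability

    Pr-nonneg : ∀ s → 0# ≤ Pr F G s
    Pr-nonneg s = ∏-nonneg (edges F G) λ e → bernoulli-nonneg e (st F G s e)

    force : Edge → Bool → States F G → States F G
    force (u , v) a s = s [ u ]≔ (lookup s u [ v ]≔ a)

    st-force : ∀ e a s → st F G (force e a s) e ≡ a
    st-force (u , v) a s rewrite lookup∘update u s (lookup s u [ v ]≔ a) =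
      lookup∘update v (lookup s u) a

    st-force-≢ : ∀ {e f} a s → e ≢ f → st F G (force e a s) f ≡ st F G s f
    st-force-≢ {u , v} {u′ , v′} a s e≢f with u Fin.≟ u′
    ... | yes ≡.refl rewrite lookup∘update u s (lookup s u [ v ]≔ a) =
      lookup∘update′ (λ { ≡.refl → e≢f ≡.refl }) (lookup s u) a
    ... | no u≢u′ rewrite lookup∘update′ (u≢u′ ∘ ≡.sym) s (lookup s u [ v ]≔ a) = ≡.refl

    -- The law of total probability for the state of `e`. By independence, conditioning amounts to
    -- overwriting that state, which avoids dividing by `p e` or `1# - p e`, either of which may
    -- vanish.
    𝔼ₛ-condition : ∀ e g →
      𝔼ₛ g ≈ p e * 𝔼ₛ (g ∘ force e true) + (1# - p e) * 𝔼ₛ (g ∘ force e false)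
    𝔼ₛ-condition e@(u , v) g = begin
      𝔼ₛ g ≈⟨ 𝔼ₛ-rows g ⟩
      -- First the whole row `u` is resampled, then the entry `v` of the fresh row.
      𝔼ᵣ g ≈⟨ 𝔼-resample rows rowWeight rowWeight-probability u g ⟩
      𝔼 rows (rowWeight u) (λ r → 𝔼ᵣ (λ s → g (s [ u ]≔ r)))
        ≈⟨ 𝔼-resample _ (λ v → bernoulli (u , v)) (λ v → bernoulli-probability (u , v)) v _ ⟩
      𝔼 (true ∷ false ∷ []) (bernoulli e) (λ a →
        𝔼 rows (rowWeight u) (λ r → 𝔼ᵣ (λ s → g (s [ u ]≔ (r [ v ]≔ a)))))
        ≈⟨ 𝔼-cong (true ∷ false ∷ []) (bernoulli e) forced ⟨
      𝔼 (true ∷ false ∷ []) (bernoulli e) (λ a → 𝔼ₛ (g ∘ force e a))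
        ≈⟨ +-congˡ (+-identityʳ _) ⟩
      p e * 𝔼ₛ (g ∘ force e true) + (1# - p e) * 𝔼ₛ (g ∘ force e false) ∎
      where
      𝔼ᵣ : (States F G → Carrier) → Carrier
      𝔼ᵣ = 𝔼 (allVecs rows |U|) (productWeight rowWeight)

      force-row : ∀ a r (s : States F G) → force e a (s [ u ]≔ r) ≡ s [ u ]≔ (r [ v ]≔ a)
      force-row a r s rewrite lookup∘update u s r = []≔-idempotent s u

      -- Resampling row `u` under the forced expectation as well gives both sides the same shape;
      -- `force-row` merges the two updates of that row.
      forced : ∀ a → 𝔼ₛ (g ∘ force e a) ≈
               𝔼 rows (rowWeight u) (λ r → 𝔼ᵣ (λ s → g (s [ u ]≔ (r [ v ]≔ a))))
      forced a = begin
        𝔼ₛ (g ∘ force e a) ≈⟨ 𝔼ₛ-rows _ ⟩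
        𝔼ᵣ (g ∘ force e a) ≈⟨ 𝔼-resample rows rowWeight rowWeight-probability u _ ⟩
        𝔼 rows (rowWeight u) (λ r → 𝔼ᵣ (λ s → g (force e a (s [ u ]≔ r))))
          ≈⟨ 𝔼-cong rows (rowWeight u) (λ r → 𝔼-cong (allVecs rows |U|) _
               (λ s → reflexive (≡.cong g (force-row a r s)))) ⟩
        𝔼 rows (rowWeight u) (λ r → 𝔼ᵣ (λ s → g (s [ u ]≔ (r [ v ]≔ a)))) ∎

    -- Conditioned runs of a strategy and their rewards.

    -- σ forces the outcomes of the probes made on the way to the subtree t, so
    -- that a run of t after those outcomes is a run of t from σ s for arbitrary s.
    record Executable (σ : States F G → States F G) (t : Strategy F G) : Set where
      field
        untouched : ∀ s → All (λ e → ∀ s′ → st F G (σ s′) e ≡ st F G s′ e) (probed F G t (σ s))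
        distinct  : ∀ s → Unique (probed F G t (σ s))
        matching  : ∀ s → IsMatching F G (output F G t (σ s))

    open Executable

    module _ {σ e d t₁ t₀} (ex : Executable σ (probe e d t₁ t₀)) where

      branch : Bool → Strategy F G
      branch a = if a then t₁ else t₀

      root-untouched : ∀ s → st F G (σ s) e ≡ st F G s e
      root-untouched s with st F G (σ s) e in eq | untouched ex s
      ... | _ | e-untouched ∷ _ = ≡.trans (≡.sym eq) (e-untouched s)

      outcome : ∀ a s → st F G (σ (force e a s)) e ≡ a
      outcome a s = ≡.trans (root-untouched (force e a s)) (st-force e a s)

      probed-branch : ∀ a s → probed F G (probe e d t₁ t₀) (σ (force e a s)) ≡
                              e ∷ probed F G (branch a) (σ (force e a s))
      probed-branch a s = probed-step {d = d} {t₁ = t₁} {t₀} (outcome a s)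

      output-branch : ∀ a s → output F G (probe e d t₁ t₀) (σ (force e a s)) ≡
                              (if a ∧ d then e ∷ output F G t₁ (σ (force e a s))
                                        else output F G (branch a) (σ (force e a s)))
      output-branch a s = output-step {t₁ = t₁} {t₀} (outcome a s)

      -- By distinctness `e` is not probed again below the root, so forcing it alters no state that
      -- the subtree reads.
      executable-branch : ∀ a → Executable (σ ∘ force e a) (branch a)
      executable-branch a .untouched s
        with ≡.subst Unique (probed-branch a s) (distinct ex (force e a s))
           | ≡.subst (All _) (probed-branch a s) (untouched ex (force e a s))
      ... | e∉ ∷ _ | _ ∷ us = All.zipWith
        (λ (e≢f , u) s′ → ≡.trans (u (force e a s′)) (st-force-≢ a s′ e≢f)) (e∉ , us)
      executable-branch a .distinct s
        with ≡.subst Unique (probed-branch a s) (distinct ex (force e a s))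
      ... | _ ∷ u = u
      executable-branch a .matching s =
        matching-branch a d {e} {t₁} {t₀} {σ (force e a s)}
          (≡.subst (IsMatching F G) (output-branch a s) (matching ex (force e a s)))

      filter-branch-⊆ : ∀ v a s → filter (at? v) (probed F G (branch a) (σ (force e a s))) ⊆
                                  filter (at? v) (probed F G (probe e d t₁ t₀) (σ (force e a s)))
      filter-branch-⊆ v a s = ≡.subst
        (λ es → filter (at? v) (probed F G (branch a) (σ (force e a s))) ⊆ filter (at? v) es)
        (≡.sym (probed-branch a s))
        (filter⁺ (at? v) (at? v) (λ { ≡.refl → id }) (e ∷ʳ ⊆-refl))

      filter-branch-∷ : ∀ {v} a s → proj₂ e ≡ v →
        filter (at? v) (probed F G (probe e d t₁ t₀) (σ (force e a s))) ≡
        e ∷ filter (at? v) (probed F G (branch a) (σ (force e a s)))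
      filter-branch-∷ {v} a s e-at =
        ≡.trans (≡.cong (filter (at? v)) (probed-branch a s)) (filter-accept (at? v) e-at)

    -- The start of the induction, with nothing forced. Strings in each `𝒞 v` are duplicate-free,
    -- and every edge is seen by one `v`, so no edge is probed twice.
    admissible⇒executable : ∀ {t} → Admissible F G t → Executable id t
    admissible⇒executable ad .untouched s = All.tabulate λ _ _ → ≡.refl
    admissible⇒executable ad .distinct s =
      unique-fibres Fin._≟_ proj₂ λ v → 𝒞-distinct (Admissible.constraint ad s v)
    admissible⇒executable ad .matching = Admissible.matching ad

    𝒞-sublist : ∀ {v es es′} → es ∈ 𝒞 v → es′ ⊆ es → es′ ∈ 𝒞 v
    𝒞-sublist es∈𝒞 es′⊆es with _ , es↭ ← sublist⇒↭++ es′⊆es =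
      𝒞-substring (𝒞-permutation es∈𝒞 es↭) (here (prefix-++ _ _))

    -- The edge weights are a parameter so that one computation serves twice: `w` yields the
    -- objective, and the indicator of the edges at `u` yields the load of `u`.
    reward : (States F G → States F G) → Strategy F G → (Edge → Carrier) → Carrier
    reward σ t φ = 𝔼ₛ (λ s → ∑ F (output F G t (σ s)) φ)

    ∑-if-∷ : ∀ d {e} es {φ : Edge → Carrier} →
             ∑ F (if d then e ∷ es else es) φ ≈ (if d then φ e else 0#) + ∑ F es φ
    ∑-if-∷ true  es = refl
    ∑-if-∷ false es = sym (+-identityˡ _)

    reward-probe : ∀ {σ e d t₁ t₀} φ → Executable σ (probe e d t₁ t₀) →
      reward σ (probe e d t₁ t₀) φ ≈
        p e * ((if d then φ e else 0#) + reward (σ ∘ force e true) t₁ φ)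
          + (1# - p e) * reward (σ ∘ force e false) t₀ φ
    reward-probe {σ} {e} {d} {t₁} {t₀} φ ex = begin
      reward σ (probe e d t₁ t₀) φ ≈⟨ 𝔼ₛ-condition e _ ⟩
      p e * 𝔼ₛ (λ s → ∑ F (output F G (probe e d t₁ t₀) (σ (force e true s))) φ)
        + (1# - p e) * 𝔼ₛ (λ s → ∑ F (output F G (probe e d t₁ t₀) (σ (force e false s))) φ)
        ≈⟨ +-cong (*-congˡ (𝔼-cong (allStates F G) (Pr F G) active))
                  (*-congˡ (𝔼-cong (allStates F G) (Pr F G) λ s →
                    reflexive (≡.cong (λ es → ∑ F es φ) (output-branch ex false s)))) ⟩
      p e * 𝔼ₛ (λ s → (if d then φ e else 0#) + ∑ F (output F G t₁ (σ (force e true s))) φ)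
        + (1# - p e) * reward (σ ∘ force e false) t₀ φ
        ≈⟨ +-congʳ (*-congˡ (trans (𝔼-distrib-+ (allStates F G) (Pr F G) _ _)
                                   (+-congʳ (𝔼ₛ-const _)))) ⟩
      p e * ((if d then φ e else 0#) + reward (σ ∘ force e true) t₁ φ)
        + (1# - p e) * reward (σ ∘ force e false) t₀ φ ∎
      where
      active : ∀ s → ∑ F (output F G (probe e d t₁ t₀) (σ (force e true s))) φ ≈
                     (if d then φ e else 0#) + ∑ F (output F G t₁ (σ (force e true s))) φ
      active s = trans (reflexive (≡.cong (λ es → ∑ F es φ) (output-branch ex true s)))
                       (∑-if-∷ d (output F G t₁ (σ (force e true s))))

    -- The random string of an online vertex.

    -- The expectation of g at the random string that v plays on behalf of t.
    lottery : Fin |V| → Strategy F G → (String → Carrier) → Carrier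
    lottery v stop              g = g []
    lottery v (probe e d t₁ t₀) g =
      if d ∧ does (at? v e) then lottery v t₀ (g ∘ (e ∷_))
                            else p e * lottery v t₁ g + (1# - p e) * lottery v t₀ g

    lottery-const : ∀ v t z → lottery v t (const z) ≈ z
    lottery-const v stop z = refl
    lottery-const v (probe e d t₁ t₀) z with d ∧ does (at? v e)
    ... | true  = lottery-const v t₀ z
    ... | false = trans (+-cong (*-congˡ (lottery-const v t₁ z)) (*-congˡ (lottery-const v t₀ z)))
                        (mix-const e z)

    -- This combined form is the inductive step of `lottery-∑`; with a constant `h` it also matches
    -- the recursion of `gain`.
    lottery-linear : ∀ v t z g h →
      lottery v t (λ es → z * g es + h es) ≈ z * lottery v t g + lottery v t h
    lottery-linear v stop z g h = refl
    lottery-linear v (probe e d t₁ t₀) z g h with d ∧ does (at? v e)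
    ... | true  = lottery-linear v t₀ z _ _
    ... | false = begin
      p e * lottery v t₁ (λ es → z * g es + h es) + (1# - p e) * lottery v t₀ (λ es → z * g es + h es)
        ≈⟨ +-cong (scale (p e) t₁) (scale (1# - p e) t₀) ⟩
      (z * (p e * lottery v t₁ g) + p e * lottery v t₁ h)
        + (z * ((1# - p e) * lottery v t₀ g) + (1# - p e) * lottery v t₀ h)
        ≈⟨ +-interchange _ _ _ _ ⟩
      (z * (p e * lottery v t₁ g) + z * ((1# - p e) * lottery v t₀ g))
        + (p e * lottery v t₁ h + (1# - p e) * lottery v t₀ h)
        ≈⟨ +-congʳ (distribˡ z _ _) ⟨
      z * (p e * lottery v t₁ g + (1# - p e) * lottery v t₀ g)
        + (p e * lottery v t₁ h + (1# - p e) * lottery v t₀ h) ∎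
      where
      scale : ∀ y t → y * lottery v t (λ es → z * g es + h es) ≈
                      z * (y * lottery v t g) + y * lottery v t h
      scale y t = trans (*-congˡ (lottery-linear v t z g h))
                        (trans (distribˡ y _ _) (+-congʳ (x*yz≈y*xz y z _)))

    lottery-∑ : ∀ v t {A : Set} (xs : List A) (z : A → Carrier) (g : A → String → Carrier) →
      ∑ F xs (λ x → z x * lottery v t (g x)) ≈ lottery v t (λ es → ∑ F xs (λ x → z x * g x es))
    lottery-∑ v t []       z g = sym (lottery-const v t 0#)
    lottery-∑ v t (x ∷ xs) z g =
      trans (+-congˡ (lottery-∑ v t xs z g))
            (sym (lottery-linear v t (z x) (g x) (λ es → ∑ F xs (λ y → z y * g y es))))

    lottery-nonneg : ∀ v t {g} → (∀ es → 0# ≤ g es) → 0# ≤ lottery v t g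
    lottery-nonneg v stop 0≤g = 0≤g []
    lottery-nonneg v (probe e d t₁ t₀) 0≤g with d ∧ does (at? v e)
    ... | true  = lottery-nonneg v t₀ (0≤g ∘ (e ∷_))
    ... | false = ≤-respˡ-≈ (+-identityˡ 0#) (+-mono-≤
      (*-nonneg (p≥0 e) (lottery-nonneg v t₁ 0≤g))
      (*-nonneg (bernoulli-nonneg e false) (lottery-nonneg v t₀ 0≤g)))

    -- Describes the support of the lottery: it draws only sublists of what some run probes at `v`,
    -- so agreement of `g` and `h` on these is enough.
    lottery-cong : ∀ v {σ} t {g h} → Executable σ t →
      (∀ s {es} → es ⊆ filter (at? v) (probed F G t (σ s)) → g es ≈ h es) →
      lottery v t g ≈ lottery v t h
    -- The empty string is a sublist whatever the state; the all-inactive state is an arbitrary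
    -- witness.
    lottery-cong v stop ex g≈h = g≈h (Vec.replicate _ (Vec.replicate _ false)) []
    lottery-cong v {σ} (probe e d t₁ t₀) {g} {h} ex g≈h = helper d (at? v e)
      where
      on-branch : ∀ a s {es} → es ⊆ filter (at? v) (probed F G (branch ex a) (σ (force e a s))) →
                  g es ≈ h es
      on-branch a s es⊆ = g≈h (force e a s) (⊆-trans es⊆ (filter-branch-⊆ ex v a s))

      mixed : p e * lottery v t₁ g + (1# - p e) * lottery v t₀ g ≈
              p e * lottery v t₁ h + (1# - p e) * lottery v t₀ h
      mixed = +-cong
        (*-congˡ (lottery-cong v t₁ (executable-branch ex true) (on-branch true)))
        (*-congˡ (lottery-cong v t₀ (executable-branch ex false) (on-branch false)))

      helper : ∀ d′ (at : Dec (proj₂ e ≡ v)) →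
        (if d′ ∧ does at then lottery v t₀ (g ∘ (e ∷_))
                           else p e * lottery v t₁ g + (1# - p e) * lottery v t₀ g) ≈
        (if d′ ∧ does at then lottery v t₀ (h ∘ (e ∷_))
                           else p e * lottery v t₁ h + (1# - p e) * lottery v t₀ h)
      -- The lottery continues in `t₀`, so the witnessing run has `e` inactive; that run probes `e`
      -- first, which matches the prepended entry.
      helper true  (yes e-at) = lottery-cong v t₀ (executable-branch ex false) λ s es⊆ →
        g≈h (force e false s) (≡.subst (_ ⊆_) (≡.sym (filter-branch-∷ ex false s e-at)) (≡.refl ∷ es⊆))
      helper true  (no _)     = mixed
      helper false _          = mixed

    -- The gain of the random string equals the reward collected at its vertex.

    -- For duplicate-free es this is val with φ in place of w.
    gain : (Edge → Carrier) → String → Carrier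
    gain φ []       = 0#
    gain φ (e ∷ es) = (1# - p e) * gain φ es + p e * φ e

    infix 8 _↾_

    _↾_ : (Edge → Carrier) → Fin |V| → Edge → Carrier
    (φ ↾ v) e = φ e * δⱽ v (proj₂ e)

    ↾-at : ∀ φ {v e} → proj₂ e ≡ v → (φ ↾ v) e ≈ φ e
    ↾-at φ e-at = trans (*-congˡ (reflexive (δⱽ-≡ (≡.sym e-at)))) (*-identityʳ _)

    ↾-not-at : ∀ φ {v e} → proj₂ e ≢ v → (φ ↾ v) e ≈ 0#
    ↾-not-at φ e-not-at = trans (*-congˡ (reflexive (δⱽ-≢ (e-not-at ∘ ≡.sym)))) (zeroʳ _)

    -- Once `e` is output, the matching property excludes every later edge at the same online
    -- vertex. This is what lets the lottery discard `t₁`.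
    reward-after-match : ∀ {σ e t₁ t₀} φ → Executable σ (probe e true t₁ t₀) →
                         reward (σ ∘ force e true) t₁ (φ ↾ proj₂ e) ≈ 0#
    reward-after-match {σ} {e} {t₁} φ ex =
      trans (𝔼-cong (allStates F G) (Pr F G) pointwise) (𝔼ₛ-const 0#)
      where
      pointwise : ∀ s → ∑ F (output F G t₁ (σ (force e true s))) (φ ↾ proj₂ e) ≈ 0#
      pointwise s with ≡.subst (IsMatching F G) (output-branch ex true s) (matching ex (force e true s))
      ... | e# ∷ _ = trans
        (∑-cong (output F G t₁ (σ (force e true s))) λ f∈ →
          ↾-not-at φ (proj₂ (All.lookup e# f∈) ∘ ≡.sym))
        (∑-zero (output F G t₁ (σ (force e true s))))

    -- Induction on the strategy. At a probe not accepted at `v`, both sides average the branches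
    -- with the same weights. At an accepted one, the active branch contributes `φ e` and nothing
    -- afterwards, which is the recursion of `gain` at a prepended `e`.
    lottery-gain : ∀ v {σ} t φ → Executable σ t → lottery v t (gain φ) ≈ reward σ t (φ ↾ v)
    lottery-gain v stop φ ex = sym (𝔼ₛ-const 0#)
    lottery-gain v {σ} (probe e d t₁ t₀) φ ex =
      trans (helper d (at? v e) ≡.refl) (sym (reward-probe (φ ↾ v) ex))
      where
      L₁ L₀ R₁ R₀ : Carrier
      L₁ = lottery v t₁ (gain φ)
      L₀ = lottery v t₀ (gain φ)
      R₁ = reward (σ ∘ force e true) t₁ (φ ↾ v)
      R₀ = reward (σ ∘ force e false) t₀ (φ ↾ v)

      L₁≈R₁ : L₁ ≈ R₁
      L₁≈R₁ = lottery-gain v t₁ φ (executable-branch ex true)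

      L₀≈R₀ : L₀ ≈ R₀
      L₀≈R₀ = lottery-gain v t₀ φ (executable-branch ex false)

      mixed : ∀ {z} → z ≈ 0# → p e * L₁ + (1# - p e) * L₀ ≈ p e * (z + R₁) + (1# - p e) * R₀
      mixed z≈0 = +-cong
        (*-congˡ (trans L₁≈R₁ (sym (trans (+-congʳ z≈0) (+-identityˡ R₁)))))
        (*-congˡ L₀≈R₀)

      -- The equation `d ≡ d′` links the generalised decision to the strategy in `ex`, as
      -- `reward-after-match` requires an accepting root.
      helper : ∀ d′ (at : Dec (proj₂ e ≡ v)) → d ≡ d′ →
        (if d′ ∧ does at then lottery v t₀ (gain φ ∘ (e ∷_)) else p e * L₁ + (1# - p e) * L₀) ≈
        p e * ((if d′ then (φ ↾ v) e else 0#) + R₁) + (1# - p e) * R₀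
      helper false at       _ = mixed refl
      helper true  (no ¬at) _ = mixed (↾-not-at φ ¬at)
      helper true  (yes ≡.refl) ≡.refl = begin
        lottery v t₀ (λ es → (1# - p e) * gain φ es + p e * φ e)
          ≈⟨ lottery-linear v t₀ (1# - p e) (gain φ) (const (p e * φ e)) ⟩
        (1# - p e) * L₀ + lottery v t₀ (const (p e * φ e))
          ≈⟨ +-cong (*-congˡ L₀≈R₀) (lottery-const v t₀ _) ⟩
        (1# - p e) * R₀ + p e * φ e ≈⟨ +-comm _ _ ⟩
        p e * φ e + (1# - p e) * R₀
          ≈⟨ +-congʳ (*-congˡ (trans (+-cong (↾-at φ ≡.refl) (reward-after-match φ ex)) (+-identityʳ _))) ⟨
        p e * ((φ ↾ v) e + R₁) + (1# - p e) * R₀ ∎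

    -- Values and capacity coefficients as gains.

    gain-zero : ∀ φ es → (∀ {e} → e ∈ es → φ e ≈ 0#) → gain φ es ≈ 0#
    gain-zero φ []       φ≈0 = refl
    gain-zero φ (e ∷ es) φ≈0 = begin
      (1# - p e) * gain φ es + p e * φ e
        ≈⟨ +-cong (*-congˡ (gain-zero φ es (φ≈0 ∘ there))) (*-congˡ (φ≈0 (here ≡.refl))) ⟩
      (1# - p e) * 0# + p e * 0# ≈⟨ +-cong (zeroʳ _) (zeroʳ _) ⟩
      0# + 0#                    ≈⟨ +-identityˡ 0# ⟩
      0#                         ∎

    q-before-first : ∀ e es → q F G (before F G e (e ∷ es)) ≡ 1#
    q-before-first e es rewrite dec-true (_≟ᴱ_ F G e e) ≡.refl = ≡.refl

    q-before-later : ∀ {e f} es → e ≢ f →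
                     q F G (before F G f (e ∷ es)) ≡ (1# - p e) * q F G (before F G f es)
    q-before-later {e} {f} es e≢f rewrite dec-false (_≟ᴱ_ F G e f) e≢f = ≡.refl

    -- Entries after the head differ from it, so each of their prefix products contains the factor
    -- `1# - p e`; pulling it out leaves `val` of the tail.
    val≈gain : ∀ {es} → Unique es → val F G es ≈ gain w es
    val≈gain {[]}     []       = refl
    val≈gain {e ∷ es} (e∉ ∷ u) = begin
      w e * p e * q F G (before F G e (e ∷ es)) + ∑ F es (λ f → w f * p f * q F G (before F G f (e ∷ es)))
        ≈⟨ +-cong
             (trans (*-congˡ (reflexive (q-before-first e es))) (trans (*-identityʳ _) (*-comm _ _)))
             (∑-cong es λ {f} f∈ → trans (*-congˡ (reflexive (q-before-later es (All.lookup e∉ f∈))))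
                                         (x*yz≈y*xz (w f * p f) (1# - p e) _)) ⟩
      p e * w e + ∑ F es (λ f → (1# - p e) * (w f * p f * q F G (before F G f es)))
        ≈⟨ +-congˡ (trans (sym (*-distribˡ-∑ es (1# - p e) _)) (*-congˡ (val≈gain u))) ⟩
      p e * w e + (1# - p e) * gain w es ≈⟨ +-comm _ _ ⟩
      (1# - p e) * gain w es + p e * w e ∎

    incident : Fin |U| → Edge → Carrier
    incident u e = δᵁ u (proj₁ e)

    incident-≡ : ∀ u e → u ≡ proj₁ e → incident u e ≈ 1#
    incident-≡ u e = reflexive ∘ δᵁ-≡

    incident-≢ : ∀ u e → u ≢ proj₁ e → incident u e ≈ 0#
    incident-≢ u e = reflexive ∘ δᵁ-≢

    incident-at : ∀ {u v e} → proj₂ e ≡ v → e ≢ (u , v) → incident u e ≈ 0#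
    incident-at {u} {v} {e} ≡.refl e≢ = incident-≢ u e λ { ≡.refl → e≢ ≡.refl }

    gain-incident-∉ : ∀ {u v es} → All (λ e → proj₂ e ≡ v) es → (u , v) ∉ es →
                      gain (incident u) es ≈ 0#
    gain-incident-∉ {u} {v} {es} at uv∉ = gain-zero (incident u) es λ e∈ →
      incident-at {u} (All.lookup at e∈) λ { ≡.refl → uv∉ e∈ }

    -- All entries lie at `v`, so `(u , v)` is the only one meeting `u`. The recursion of `gain`
    -- collects one factor for each entry before it, and these multiply to `q` of the prefix.
    gain-incident-∈ : ∀ {u v es} → All (λ e → proj₂ e ≡ v) es → Unique es → (u , v) ∈ es →
                      p (u , v) * q F G (before F G (u , v) es) ≈ gain (incident u) es
    gain-incident-∈ {u} {v} {e ∷ es} (_ ∷ at) (e∉ ∷ _) (here ≡.refl) = begin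
      p e * q F G (before F G e (e ∷ es)) ≈⟨ *-congˡ (reflexive (q-before-first e es)) ⟩
      p e * 1#                            ≈⟨ *-congˡ (incident-≡ u e ≡.refl) ⟨
      p e * incident u e                  ≈⟨ +-identityˡ _ ⟨
      0# + p e * incident u e             ≈⟨ +-congʳ (zeroʳ _) ⟨
      (1# - p e) * 0# + p e * incident u e
        ≈⟨ +-congʳ (*-congˡ (gain-incident-∉ at λ e∈ → All.lookup e∉ e∈ ≡.refl)) ⟨
      (1# - p e) * gain (incident u) es + p e * incident u e ∎
    gain-incident-∈ {u} {v} {e ∷ es} (e-at ∷ at) (e∉ ∷ un) (there uv∈) = begin
      p (u , v) * q F G (before F G (u , v) (e ∷ es)) ≈⟨ *-congˡ (reflexive (q-before-later es e≢uv)) ⟩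
      p (u , v) * ((1# - p e) * q F G (before F G (u , v) es)) ≈⟨ x*yz≈y*xz _ _ _ ⟩
      (1# - p e) * (p (u , v) * q F G (before F G (u , v) es)) ≈⟨ *-congˡ (gain-incident-∈ at un uv∈) ⟩
      (1# - p e) * gain (incident u) es      ≈⟨ +-identityʳ _ ⟨
      (1# - p e) * gain (incident u) es + 0# ≈⟨ +-congˡ (zeroʳ (p e)) ⟨
      (1# - p e) * gain (incident u) es + p e * 0#
        ≈⟨ +-congˡ (*-congˡ (incident-at e-at e≢uv)) ⟨
      (1# - p e) * gain (incident u) es + p e * incident u e ∎
      where
      e≢uv : e ≢ (u , v)
      e≢uv = All.lookup e∉ uv∈

    -- Loads of offline vertices and splitting rewards over `V`.

    matching-incident≤1 : ∀ u {es} → IsMatching F G es → ∑ F es (incident u) ≤ 1#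
    matching-incident≤1 u {[]}     []       = 0≤1
    matching-incident≤1 u {e ∷ es} (e# ∷ m) with u Fin.≟ proj₁ e
    ... | yes ≡.refl = ≤-reflexive (begin
      1# + ∑ F es (incident u)
        ≈⟨ +-congˡ (trans (∑-cong es λ {f} f∈ → incident-≢ u f (proj₁ (All.lookup e# f∈))) (∑-zero es)) ⟩
      1# + 0# ≈⟨ +-identityʳ 1# ⟩
      1#      ∎)
    ... | no _ = ≤-respˡ-≈ (sym (+-identityˡ _)) (matching-incident≤1 u m)

    ∑-↾ : ∀ φ e → ∑ F (allFin |V|) (λ v → (φ ↾ v) e) ≈ φ e
    ∑-↾ φ e = δⱽ-select (const (φ e)) (allFin⁺ |V|) (∈-allFin (proj₂ e))

    -- Every edge has exactly one online endpoint, so the restrictions of `φ` add up to `φ`.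
    ∑-reward-↾ : ∀ σ t φ → ∑ F (allFin |V|) (λ v → reward σ t (φ ↾ v)) ≈ reward σ t φ
    ∑-reward-↾ σ t φ = trans (∑-𝔼-swap (allStates F G) (Pr F G) (allFin |V|) _)
      (𝔼-cong (allStates F G) (Pr F G) λ s →
        trans (∑-swap (allFin |V|) (output F G t (σ s)) (λ v → φ ↾ v))
              (∑-cong (output F G t (σ s)) λ _ → ∑-↾ φ _))

    -- The LP solution induced by an algorithm.

    module _ (A : OfflineProbingAlgorithm F G) where
      open OfflineProbingAlgorithm A

      𝔼ᵨ : (Fin seeds → Carrier) → Carrier
      𝔼ᵨ = 𝔼 (allFin seeds) π

      π-probability : IsProbability (allFin seeds) π
      π-probability = trans (∑-cong (allFin seeds) λ _ → *-identityʳ _) ∑π≈1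

      expectedReward : (Edge → Carrier) → Carrier
      expectedReward φ = 𝔼ᵨ (λ r → reward id (strategy r) φ)

      expectedWeight≈expectedReward : expectedWeight F G A ≈ expectedReward w
      expectedWeight≈expectedReward = ∑-cong (allFin seeds) λ {r} _ →
        trans (∑-cong (allStates F G) λ _ → *-assoc (π r) _ _)
              (sym (*-distribˡ-∑ (allStates F G) (π r) _))

      expectedReward-incident≤1 : ∀ u → expectedReward (incident u) ≤ 1#
      expectedReward-incident≤1 u = ≤-respʳ-≈ (𝔼-const (allFin seeds) π π-probability 1#)
        (𝔼-mono (allFin seeds) π≥0 λ r → ≤-respʳ-≈ (𝔼ₛ-const 1#)
          (𝔼-mono (allStates F G) Pr-nonneg λ s →
            matching-incident≤1 u (Admissible.matching (admissible r) s)))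

      -- The expectation of the indicator of `es` is the probability that the lottery of `v`, under
      -- a random seed, draws exactly `es`.
      x : Fin |V| → String → Carrier
      x v es = 𝔼ᵨ (λ r → lottery v (strategy r) (δ es))

      -- The lottery draws only strings of `𝒞 v`, and each is enumerated once, so the sum of
      -- indicators selects `g` at the drawn string.
      ∑-x : ∀ v g → ∑ F (𝒞 v) (λ es → g es * x v es) ≈ 𝔼ᵨ (λ r → lottery v (strategy r) g)
      ∑-x v g = begin
        ∑ F (𝒞 v) (λ es → g es * x v es) ≈⟨ ∑-cong (𝒞 v) (λ _ → *-𝔼 (allFin seeds) π _ _) ⟩
        ∑ F (𝒞 v) (λ es → 𝔼ᵨ (λ r → g es * lottery v (strategy r) (δ es)))
          ≈⟨ ∑-𝔼-swap (allFin seeds) π (𝒞 v) _ ⟩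
        𝔼ᵨ (λ r → ∑ F (𝒞 v) (λ es → g es * lottery v (strategy r) (δ es)))
          ≈⟨ 𝔼-cong (allFin seeds) π (λ r → trans (lottery-∑ v (strategy r) (𝒞 v) g δ)
               (lottery-cong v (strategy r) (admissible⇒executable (admissible r)) λ s es⊆ →
                 δ-select g (𝒞-unique v) (𝒞-sublist (Admissible.constraint (admissible r) s v) es⊆))) ⟩
        𝔼ᵨ (λ r → lottery v (strategy r) g) ∎

      ∑∑-x-gain : ∀ φ → ∑ F (allFin |V|) (λ v → ∑ F (𝒞 v) (λ es → gain φ es * x v es)) ≈ expectedReward φ
      ∑∑-x-gain φ = begin
        ∑ F (allFin |V|) (λ v → ∑ F (𝒞 v) (λ es → gain φ es * x v es))
          ≈⟨ ∑-cong (allFin |V|) (λ {v} _ → trans (∑-x v (gain φ))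
               (𝔼-cong (allFin seeds) π λ r →
                 lottery-gain v (strategy r) φ (admissible⇒executable (admissible r)))) ⟩
        ∑ F (allFin |V|) (λ v → 𝔼ᵨ (λ r → reward id (strategy r) (φ ↾ v)))
          ≈⟨ ∑-𝔼-swap (allFin seeds) π (allFin |V|) _ ⟩
        𝔼ᵨ (λ r → ∑ F (allFin |V|) (λ v → reward id (strategy r) (φ ↾ v)))
          ≈⟨ 𝔼-cong (allFin seeds) π (λ r → ∑-reward-↾ id (strategy r) φ) ⟩
        expectedReward φ ∎

      lpSolution : LPSolution F G
      lpSolution .LPSolution.x = x
      lpSolution .LPSolution.x≥0 v {es} _ =
        𝔼-nonneg (allFin seeds) π≥0 λ r → lottery-nonneg v (strategy r) (δ-nonneg es)
      lpSolution .LPSolution.capacity u =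
        ≤-respˡ-≈ (sym capacity≈expectedReward) (expectedReward-incident≤1 u)
        where
        capacity≈expectedReward = trans
          -- The sum extends to all of `𝒞 v`, since strings without `(u , v)` have gain zero for the
          -- indicator of `u`.
          (∑-cong (allFin |V|) λ {v} _ → ∑-filter _ (𝒞 v)
            (λ es∈ uv∈ → *-congʳ (gain-incident-∈ (𝒞-at es∈) (𝒞-distinct es∈) uv∈))
            (λ es∈ uv∉ → trans (*-congʳ (gain-incident-∉ (𝒞-at es∈) uv∉)) (zeroˡ _)))
          (∑∑-x-gain (incident u))
      lpSolution .LPSolution.total v = begin
        ∑ F (𝒞 v) (x v)                          ≈⟨ ∑-cong (𝒞 v) (λ _ → *-identityˡ _) ⟨
        ∑ F (𝒞 v) (λ es → 1# * x v es)           ≈⟨ ∑-x v (const 1#) ⟩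
        𝔼ᵨ (λ r → lottery v (strategy r) (const 1#))
          ≈⟨ 𝔼-cong (allFin seeds) π (λ r → lottery-const v (strategy r) 1#) ⟩
        𝔼ᵨ (const 1#)                            ≈⟨ π-probability ⟩
        1#                                       ∎

      objective≈expectedWeight : objective F G lpSolution ≈ expectedWeight F G A
      objective≈expectedWeight = begin
        objective F G lpSolution
          ≈⟨ ∑-cong (allFin |V|) (λ {v} _ → ∑-cong (𝒞 v) λ es∈ → *-congʳ (val≈gain (𝒞-distinct es∈))) ⟩
        ∑ F (allFin |V|) (λ v → ∑ F (𝒞 v) (λ es → gain w es * x v es)) ≈⟨ ∑∑-x-gain w ⟩
        expectedReward w   ≈⟨ expectedWeight≈expectedReward ⟨
        expectedWeight F G A ∎

    -- An algorithm attaining `opt` induces an LP solution of the same value, which `lpopt` bounds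
    -- from above.
    OPT≤LPOPT : ∀ {opt lpopt} → IsOPT F G opt → IsLPOPT F G lpopt → opt ≤ lpopt
    OPT≤LPOPT ((A , weight≈opt) , _) (_ , objective≤lpopt) =
      ≤-respˡ-≈ (trans (objective≈expectedWeight A) weight≈opt) (objective≤lpopt (lpSolution A))

theorem3p1 : ∀ {c ℓ₁ ℓ₂} (F : OrderedField c ℓ₁ ℓ₂) (G : StochasticGraph F) →
    let open OrderedField F in
    ∀ {opt lpopt : Carrier} → IsOPT F G opt → IsLPOPT F G lpopt → opt ≤ lpopt
theorem3p1 = OPT≤LPOPT
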